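{- For every integer $n\ge 1$, \[ \mu(\mathbb Z_n)=\begin{cases}\infty, & 1\le n\le 8,\\ 6, & n\ge 9.\end{cases} \] Equivalently, every admissible subset of $\mathbb Z_n$ is partitionable for $1\le n\le 8$, while for each $n\ge 9$ there is a six-element admissible subset of $\mathbb Z_n$ with no zero-sum triple partition.
   Context: $\mathbb Z_n$ denotes the (additive) cyclic group of order $n$. For a finite subset $S$ of an abelian group $G$, write $\sigma(S)=\sum_{s\in S}s\in G$. A zero-sum triple partition of $S$ is a decomposition $S=T_1\sqcup\cdots\sqcup T_m$ ($m\ge 0$) into pairwise disjoint subsets with $|T_i|=3$ and $\sigma(T_i)=0$ for every $i$ (for $m=0$ this is the empty partition of the empty set). A finite subset $S\subseteq G$ is admissible if $3\mid |S|$ and $\sigma(S)=0$; it is partitionable if it has a zero-sum triple partition, and non-partitionable otherwise. For a finite abelian group $G$, $\mu(G)$ is the least cardinality of a non-partitionable admissible subset of $G$, with $\mu(G)=\infty$ if no such subset exists. -}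

module Defs where

open import Algebra.Bundles using (AbelianGroup)
open import Algebra.Definitions using (Associative; Commutative; LeftIdentity; LeftInverse)
open import Algebra.Consequences.Propositional using (comm∧idˡ⇒id; comm∧invˡ⇒inv)
open import Data.Fin using (Fin; toℕ)
open import Data.Fin.Properties using (toℕ-injective; toℕ-fromℕ<; toℕ<n)
open import Data.List using (List; length; foldr)
open import Data.List.Relation.Unary.All using (All)
open import Data.List.Relation.Unary.AllPairs using (AllPairs)
open import Data.List.Relation.Unary.Any using (Any)
open import Data.Nat using (ℕ; NonZero; _+_; _∸_; _≤_)
open import Data.Nat.Divisibility using (_∣_)
open import Data.Nat.DivMod using (_%_; _mod_; m%n<n; m<n⇒m%n≡m; %-distribˡ-+; m%n%n≡m%n; n%n≡0)
open import Data.Nat.Properties using (+-assoc; +-comm; m∸n+n≡m; <⇒≤)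
open import Data.Product using (∃-syntax; _×_)
open import Function using (_⇔_)
open import Level using (0ℓ; _⊔_)
open import Relation.Binary.PropositionalEquality
  using (_≡_; cong; cong₂; isEquivalence; module ≡-Reasoning)
open import Relation.Nullary using (¬_)
open import Relation.Nullary.Construct.Add.Supremum using (_⁺; [_]; ⊤⁺)

module _ {c ℓ} (G : AbelianGroup c ℓ) where

  open AbelianGroup G using (Carrier; _≈_; _∙_; ε; setoid)
  open import Data.List.Membership.Setoid setoid using (_∈_)
  open import Data.List.Relation.Binary.Disjoint.Setoid setoid using (Disjoint)
  open import Data.List.Relation.Unary.Unique.Setoid setoid using (Unique)

  -- A finite subset is given by a duplicate-free listing of its elements; the
  -- order of the listing does not affect any of the notions below.
  record FiniteSubset : Set (c ⊔ ℓ) where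
    constructor mkFiniteSubset
    field
      elements : List Carrier
      unique   : Unique elements

  open FiniteSubset public

  infix 4 _∈ₛ_

  _∈ₛ_ : Carrier → FiniteSubset → Set (c ⊔ ℓ)
  x ∈ₛ S = x ∈ elements S

  card : FiniteSubset → ℕ
  card S = length (elements S)

  -- The group is written multiplicatively in AbelianGroup, so this is the sum
  -- of the elements.
  σ : FiniteSubset → Carrier
  σ S = foldr _∙_ ε (elements S)

  ZeroSumTriple : FiniteSubset → Set ℓ
  ZeroSumTriple T = card T ≡ 3 × σ T ≈ ε

  record ZeroSumTriplePartition (S : FiniteSubset) : Set (c ⊔ ℓ) where
    field
      parts    : List FiniteSubset
      triples  : All ZeroSumTriple parts
      disjoint : AllPairs (λ T U → Disjoint (elements T) (elements U)) parts
      union    : ∀ x → x ∈ₛ S ⇔ Any (x ∈ₛ_) parts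

  Admissible : FiniteSubset → Set ℓ
  Admissible S = 3 ∣ card S × σ S ≈ ε

  Partitionable : FiniteSubset → Set (c ⊔ ℓ)
  Partitionable S = ZeroSumTriplePartition S

  NonPartitionable : FiniteSubset → Set (c ⊔ ℓ)
  NonPartitionable S = ¬ Partitionable S

  -- μ≡ v expresses μ(G) = v, where ⊤⁺ : ℕ ⁺ plays the role of ∞.  It is a
  -- relation because finding the least cardinality is not computable for an
  -- arbitrary group.
  μ≡ : ℕ ⁺ → Set (c ⊔ ℓ)
  μ≡ [ k ] = (∃[ S ] (Admissible S × NonPartitionable S × card S ≡ k))
           × (∀ S → Admissible S → NonPartitionable S → k ≤ card S)
  μ≡ ⊤⁺    = ¬ (∃[ S ] (Admissible S × NonPartitionable S))

module _ (n : ℕ) .{{_ : NonZero n}} where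

  private

    infixl 6 _⊕_

    _⊕_ : Fin n → Fin n → Fin n
    x ⊕ y = (toℕ x + toℕ y) mod n

    0ₙ : Fin n
    0ₙ = 0 mod n

    ⊖_ : Fin n → Fin n
    ⊖ x = (n ∸ toℕ x) mod n

    toℕ-mod : ∀ m → toℕ (m mod n) ≡ m % n
    toℕ-mod m = toℕ-fromℕ< (m%n<n m n)

    toℕ-% : ∀ (x : Fin n) → toℕ x % n ≡ toℕ x
    toℕ-% x = m<n⇒m%n≡m (toℕ<n x)

    %-+ˡ : ∀ a b → (a % n + b) % n ≡ (a + b) % n
    %-+ˡ a b = begin
      (a % n + b) % n          ≡⟨ %-distribˡ-+ (a % n) b n ⟩
      (a % n % n + b % n) % n  ≡⟨ cong (λ z → (z + b % n) % n) (m%n%n≡m%n a n) ⟩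
      (a % n + b % n) % n      ≡⟨ %-distribˡ-+ a b n ⟨
      (a + b) % n              ∎
      where open ≡-Reasoning

    ⊕-comm : Commutative _≡_ _⊕_
    ⊕-comm x y = cong (_mod n) (+-comm (toℕ x) (toℕ y))

    ⊕-assoc : Associative _≡_ _⊕_
    ⊕-assoc x y z = toℕ-injective (begin
      toℕ (x ⊕ y ⊕ z)                ≡⟨ toℕ-mod _ ⟩
      (toℕ (x ⊕ y) + toℕ z) % n      ≡⟨ cong (λ w → (w + toℕ z) % n) (toℕ-mod _) ⟩
      ((toℕ x + toℕ y) % n + toℕ z) % n  ≡⟨ %-+ˡ _ _ ⟩
      (toℕ x + toℕ y + toℕ z) % n    ≡⟨ cong (_% n) (+-assoc (toℕ x) _ _) ⟩
      (toℕ x + (toℕ y + toℕ z)) % n  ≡⟨ cong (_% n) (+-comm (toℕ x) _) ⟩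
      (toℕ y + toℕ z + toℕ x) % n    ≡⟨ %-+ˡ _ _ ⟨
      ((toℕ y + toℕ z) % n + toℕ x) % n  ≡⟨ cong (λ w → (w + toℕ x) % n) (toℕ-mod _) ⟨
      (toℕ (y ⊕ z) + toℕ x) % n      ≡⟨ cong (_% n) (+-comm _ (toℕ x)) ⟩
      (toℕ x + toℕ (y ⊕ z)) % n      ≡⟨ toℕ-mod _ ⟨
      toℕ (x ⊕ (y ⊕ z))              ∎)
      where open ≡-Reasoning

    ⊕-identityˡ : LeftIdentity _≡_ 0ₙ _⊕_
    ⊕-identityˡ x = toℕ-injective (begin
      toℕ (0ₙ ⊕ x)            ≡⟨ toℕ-mod _ ⟩
      (toℕ 0ₙ + toℕ x) % n    ≡⟨ cong (λ w → (w + toℕ x) % n) (toℕ-mod 0) ⟩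
      (0 % n + toℕ x) % n     ≡⟨ %-+ˡ 0 _ ⟩
      toℕ x % n               ≡⟨ toℕ-% x ⟩
      toℕ x                   ∎)
      where open ≡-Reasoning

    ⊕-inverseˡ : LeftInverse _≡_ 0ₙ ⊖_ _⊕_
    ⊕-inverseˡ x = toℕ-injective (begin
      toℕ ((⊖ x) ⊕ x)                ≡⟨ toℕ-mod _ ⟩
      (toℕ (⊖ x) + toℕ x) % n        ≡⟨ cong (λ w → (w + toℕ x) % n) (toℕ-mod _) ⟩
      ((n ∸ toℕ x) % n + toℕ x) % n  ≡⟨ %-+ˡ (n ∸ toℕ x) _ ⟩
      (n ∸ toℕ x + toℕ x) % n        ≡⟨ cong (_% n) (m∸n+n≡m (<⇒≤ (toℕ<n x))) ⟩
      n % n                          ≡⟨ m%n%n≡m%n n n ⟨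
      n % n % n                      ≡⟨ cong (_% n) (n%n≡0 n) ⟩
      0 % n                          ≡⟨ toℕ-mod 0 ⟨
      toℕ 0ₙ                         ∎)
      where open ≡-Reasoning

  ℤ/ : AbelianGroup 0ℓ 0ℓ
  ℤ/ = record
    { Carrier        = Fin n
    ; _≈_            = _≡_
    ; _∙_            = _⊕_
    ; ε              = 0ₙ
    ; _⁻¹            = ⊖_
    ; isAbelianGroup = record
      { isGroup = record
        { isMonoid = record
          { isSemigroup = record
            { isMagma = record { isEquivalence = isEquivalence ; ∙-cong = cong₂ _⊕_ }
            ; assoc   = ⊕-assoc
            }
          ; identity = comm∧idˡ⇒id ⊕-comm ⊕-identityˡ
          }
        ; inverse = comm∧invˡ⇒inv ⊕-comm ⊕-inverseˡ
        ; ⁻¹-cong = cong ⊖_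
        }
      ; comm = ⊕-comm
      }
    }

{-# OPTIONS --safe #-}
-- For n ≥ 9 the set {±1, ±2, ±4} works: a triple containing x and −x sums to
-- a nonzero element, and every other triple sum ±1 ± 2 ± 4 is nonzero of
-- absolute value at most 7 < n.  For n ≤ 8 an admissible set has 0, 3 or 6
-- elements, and every set lists a permutation of a sublist of allFin n, so the
-- six-element case is decided by running through all sublists and splittings.
module Submission where

open import Defs
open import Algebra.Bundles using (AbelianGroup)
open import Data.Fin as Fin using (Fin; toℕ; fromℕ<)
open import Data.Fin.Properties as Fin using (toℕ-fromℕ<; toℕ-injective; all?; any?)
open import Data.List using (List; []; _∷_; _++_; length; foldr; map; concat;
  filter; tabulate; allFin)
open import Data.List.Properties using (++-identityʳ; map-tabulate; tabulate-cong)
open import Data.List.Membership.DecPropositional using (_∈?_)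
open import Data.List.Membership.Propositional using (_∈_)
open import Data.List.Membership.Propositional.Properties
  using (∈-tabulate⁻; ∈-map⁺; ∈-++⁺ˡ; ∈-++⁺ʳ; ∈-filter⁺; ∈-filter⁻; ∈-allFin)
open import Data.List.Membership.Propositional.Properties.WithK using (unique∧set⇒bag)
open import Data.List.Relation.Binary.BagAndSetEquality using (∼bag⇒↭)
open import Data.List.Relation.Binary.Permutation.Propositional using (_↭_; ↭-refl; ↭-trans; ↭-sym; prep; ↭⇒↭ₛ)
open import Data.List.Relation.Binary.Permutation.Propositional.Properties using (shift; ↭-length)
import Data.List.Relation.Binary.Permutation.Setoid.Properties as Permutationₛ
open import Data.List.Relation.Unary.All as All using (All; []; _∷_)
import Data.List.Relation.Unary.All.Properties as All
open import Data.List.Relation.Unary.AllPairs using (AllPairs; []; _∷_)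
import Data.List.Relation.Unary.AllPairs.Properties as AllPairs
open import Data.List.Relation.Unary.Any as Any using (Any; here; there)
import Data.List.Relation.Unary.Any.Properties as Any
open import Data.List.Relation.Unary.Unique.Propositional using (Unique)
open import Data.List.Relation.Unary.Unique.Propositional.Properties using (allFin⁺; filter⁺)
open import Data.Nat using (ℕ; suc; NonZero; _+_; _*_; _≤_; _<_; _≥_; _≟_; _<?_; _≤?_)
open import Data.Nat.Divisibility using (_∣_; divides; m%n≡0⇒n∣m; n∣m⇒m%n≡0)
open import Data.Nat.DivMod using (_%_; m%n<n; %-distribˡ-+; m%n%n≡m%n; m*n%n≡0)
open import Data.Nat.ListAction using (sum)
open import Data.Nat.Properties
  using (+-mono-<-≤; *-monoˡ-≤; *-distribˡ-+; *-cancelʳ-<; *-identityˡ; <⇒≢; <⇒≱;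
         ≤-reflexive; m≤m+n; ≤-trans; m≤n⇒∃[o]m+o≡n; module ≤-Reasoning)
open import Data.Nat.Tactic.RingSolver using (solve-∀)
open import Data.Product using (_×_; _,_; proj₁; proj₂; ∃-syntax; Σ-syntax)
open import Data.Vec using ([]; _∷_; lookup)
open import Function using (_⇔_; mk⇔; _∘_; Equivalence)
open import Relation.Binary using (Rel)
open import Relation.Binary.PropositionalEquality
  using (_≡_; _≢_; refl; sym; trans; cong; subst; module ≡-Reasoning)
open import Relation.Nullary using (¬_; yes; no; contradiction)
open import Relation.Nullary.Decidable using (from-yes; _×-dec_; _→-dec_; ¬?)
open import Relation.Nullary.Construct.Add.Supremum using ([_]; ⊤⁺)
open import Relation.Unary using (Pred; Decidable)

-- Triple partitions in an arbitrary abelian group.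

AllPairs-++⁻ : ∀ {a r} {A : Set a} {R : Rel A r} xs {ys} → AllPairs R (xs ++ ys) →
               AllPairs R xs × AllPairs R ys × All (λ x → All (R x) ys) xs
AllPairs-++⁻ []       Rys        = [] , Rys , []
AllPairs-++⁻ (x ∷ xs) (Rx ∷ Rxs) with AllPairs-++⁻ xs Rxs
... | Rxs′ , Rys , Rxsys = All.++⁻ˡ xs Rx ∷ Rxs′ , Rys , All.++⁻ʳ xs Rx ∷ Rxsys

module _ {c ℓ} (G : AbelianGroup c ℓ) where

  open AbelianGroup G using (setoid) renaming (trans to ≈-trans; sym to ≈-sym)
  open import Data.List.Relation.Binary.Disjoint.Setoid setoid using (Disjoint)
  open import Data.List.Relation.Binary.Permutation.Setoid setoid
    using () renaming (_↭_ to _↭ₛ_; ↭-refl to ↭ₛ-refl; ↭-sym to ↭ₛ-sym; ↭-reflexive to ↭ₛ-reflexive)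
  open import Data.List.Relation.Unary.Unique.Setoid setoid using () renaming (Unique to Uniqueₛ)
  open import Data.List.Membership.Setoid.Properties using (∈-concat⁺; ∈-concat⁻)

  -- An element shared by two parts would occur twice in the concatenation.
  unique-concat⇒disjoint : ∀ (Ts : List (FiniteSubset G)) → Uniqueₛ (concat (map elements Ts)) →
                           AllPairs (λ T U → Disjoint (elements T) (elements U)) Ts
  unique-concat⇒disjoint []       _ = []
  unique-concat⇒disjoint (T ∷ Ts) u with AllPairs-++⁻ (elements T) u
  ... | _ , uTs , T#Ts = All.tabulate (λ U∈Ts {_} (v∈T , v∈U) →
    let v∈Ts         = ∈-concat⁺ setoid (Any.map⁺ (Any.map (λ { refl → v∈U }) U∈Ts))
        t#Ts , v≈t   = All.lookupAny T#Ts v∈T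
        t≉u  , v≈u   = All.lookupAny t#Ts v∈Ts
    in t≉u (≈-trans (≈-sym v≈t) v≈u)) ∷ unique-concat⇒disjoint Ts uTs

  -- Reduces building a partition to rearranging the listing of `S`: disjointness comes from
  -- uniqueness of that listing, the union from invariance of membership under permutation.
  partition-of-↭ : ∀ {S} Ts → All (ZeroSumTriple G) Ts → concat (map elements Ts) ↭ₛ elements S →
                   Partitionable G S
  partition-of-↭ {S} Ts zs p = record
    { parts    = Ts
    ; triples  = zs
    ; disjoint = unique-concat⇒disjoint Ts (Permutationₛ.Unique-resp-↭ setoid (↭ₛ-sym p) (unique S))
    ; union    = λ x → mk⇔
        (λ x∈S → Any.map⁻ (∈-concat⁻ setoid (map elements Ts) (Permutationₛ.∈-resp-↭ setoid (↭ₛ-sym p) x∈S)))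
        (λ x∈Ts → Permutationₛ.∈-resp-↭ setoid p (∈-concat⁺ setoid (Any.map⁺ x∈Ts)))
    }

  card≡0⇒partitionable : ∀ S → card G S ≡ 0 → Partitionable G S
  card≡0⇒partitionable (mkFiniteSubset [] _) refl = partition-of-↭ [] [] ↭ₛ-refl

  card≡3⇒partitionable : ∀ S → ZeroSumTriple G S → Partitionable G S
  card≡3⇒partitionable S z = partition-of-↭ (S ∷ []) (z ∷ []) (↭ₛ-reflexive (++-identityʳ (elements S)))

  -- Cardinality 0 is handled by the empty partition and 3 by `S` itself as the only part; the next
  -- multiple of 3 is 6.
  nonPartitionable⇒6≤card : ∀ S → Admissible G S → NonPartitionable G S → 6 ≤ card G S
  nonPartitionable⇒6≤card S (divides 0 c≡ , z) np = contradiction (card≡0⇒partitionable S c≡) np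
  nonPartitionable⇒6≤card S (divides 1 c≡ , z) np = contradiction (card≡3⇒partitionable S (c≡ , z)) np
  nonPartitionable⇒6≤card S (divides (suc (suc q)) c≡ , z) np =
    subst (6 ≤_) (sym c≡) (m≤m+n 6 (q * 3))

  -- The part containing `x` serves. One such triple is enough to refute partitionability of a
  -- nonempty set all of whose triples have nonzero sum.
  triple-in-partitionable : ∀ S {x} → Partitionable G S → _∈ₛ_ G x S →
                            ∃[ T ] (ZeroSumTriple G T × (∀ {y} → _∈ₛ_ G y T → _∈ₛ_ G y S))
  triple-in-partitionable S P x∈S with Equivalence.to (ZeroSumTriplePartition.union P _) x∈S
  ... | x∈Ts = Any.lookup x∈Ts , proj₁ (All.lookupAny triples x∈Ts) , λ y∈T →
        Equivalence.from (union _) (lookup-∈ x∈Ts y∈T)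
    where
    open ZeroSumTriplePartition P
    lookup-∈ : ∀ {x y Ts} (x∈Ts : Any (_∈ₛ_ G x) Ts) → _∈ₛ_ G y (Any.lookup x∈Ts) → Any (_∈ₛ_ G y) Ts
    lookup-∈ (here _)     y∈T = here y∈T
    lookup-∈ (there x∈Ts) y∈T = there (lookup-∈ x∈Ts y∈T)

-- Enumerating splittings and sublists.

module _ {a} {A : Set a} where

  splits : List A → List (List A × List A)
  splits []       = ([] , []) ∷ []
  splits (x ∷ xs) = map (λ (ys , zs) → x ∷ ys , zs) (splits xs) ++ map (λ (ys , zs) → ys , x ∷ zs) (splits xs)

  splits-↭ : ∀ xs → All (λ (ys , zs) → ys ++ zs ↭ xs) (splits xs)
  splits-↭ []       = ↭-refl ∷ []
  splits-↭ (x ∷ xs) = All.++⁺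
    (All.map⁺ (All.map (prep x) (splits-↭ xs)))
    (All.map⁺ (All.map (λ {(ys , zs)} p → ↭-trans (shift x ys zs) (prep x p)) (splits-↭ xs)))

  sublists : List A → List (List A)
  sublists xs = map proj₁ (splits xs)

  -- Elements satisfying `P` go to the left half, all others to the right.
  filter-split : ∀ {p} {P : Pred A p} (P? : Decidable P) xs → ∃[ ys ] ((filter P? xs , ys) ∈ splits xs)
  filter-split P? []       = [] , here refl
  filter-split P? (x ∷ xs) with filter-split P? xs | P? x
  ... | ys , i | yes _ = ys , ∈-++⁺ˡ (∈-map⁺ _ i)
  ... | ys , i | no  _ = x ∷ ys , ∈-++⁺ʳ _ (∈-map⁺ _ i)

  filter-∈-sublists : ∀ {p} {P : Pred A p} (P? : Decidable P) xs → filter P? xs ∈ sublists xs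
  filter-∈-sublists P? xs = ∈-map⁺ proj₁ (proj₂ (filter-split P? xs))

-- Two duplicate-free lists with the same members are permutations of each other. This replaces an
-- arbitrary listing of a subset by a sublist of `allFin n`, which a finite search can reach.
↭-filter-allFin : ∀ {n} {xs : List (Fin n)} → Unique xs → filter (λ i → _∈?_ Fin._≟_ i xs) (allFin n) ↭ xs
↭-filter-allFin {n} {xs} u = ∼bag⇒↭ (unique∧set⇒bag (filter⁺ ∈xs? (allFin⁺ n)) u
  (mk⇔ (λ i∈ → proj₂ (∈-filter⁻ ∈xs? {xs = allFin n} i∈)) (λ i∈xs → ∈-filter⁺ ∈xs? (∈-allFin _) i∈xs)))
  where ∈xs? = λ i → _∈?_ Fin._≟_ i xs

-- Sums in `ℤ/ n` and the finite search for `n ≤ 8`.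

module _ (n : ℕ) .{{_ : NonZero n}} where

  open AbelianGroup (ℤ/ n) using (_∙_; ε; isCommutativeMonoid; setoid)

  IsZeroSumTriple : List (Fin n) → Set
  IsZeroSumTriple xs = length xs ≡ 3 × foldr _∙_ ε xs ≡ ε

  SplitsIntoTriples : List (Fin n) → Set
  SplitsIntoTriples xs = Any (λ (ys , zs) → IsZeroSumTriple ys × IsZeroSumTriple zs) (splits xs)

  -- The length bound is there to exclude cardinalities 9 and above in the same search that settles
  -- cardinality 6.
  SmallOrSplits : List (Fin n) → Set
  SmallOrSplits xs = length xs ≤ 8 × (length xs ≡ 6 → foldr _∙_ ε xs ≡ ε → SplitsIntoTriples xs)

  isZeroSumTriple? : Decidable IsZeroSumTriple
  isZeroSumTriple? xs = length xs ≟ 3 ×-dec foldr _∙_ ε xs Fin.≟ ε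

  smallOrSplits? : Decidable SmallOrSplits
  smallOrSplits? xs = length xs ≤? 8 ×-dec (length xs ≟ 6 →-dec foldr _∙_ ε xs Fin.≟ ε →-dec
    Any.any? (λ (ys , zs) → isZeroSumTriple? ys ×-dec isZeroSumTriple? zs) (splits xs))

  splitsIntoTriples⇒partitionable : ∀ S {xs} → xs ↭ elements S → SplitsIntoTriples xs → Partitionable (ℤ/ n) S
  splitsIntoTriples⇒partitionable S {xs} xs↭S i with All.lookupAny (splits-↭ xs) i
  ... | ys++zs↭xs , ys₀ , zs₀ with ys , zs ← Any.lookup i =
    partition-of-↭ (ℤ/ n) (mkFiniteSubset ys ys! ∷ mkFiniteSubset zs zs! ∷ []) (ys₀ ∷ zs₀ ∷ [])
      (↭⇒↭ₛ (subst (λ ws → ys ++ ws ↭ elements S) (sym (++-identityʳ zs)) ys++zs↭S))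
    where
    ys++zs↭S = ↭-trans ys++zs↭xs xs↭S
    parts!   = AllPairs-++⁻ ys (Permutationₛ.Unique-resp-↭ setoid (↭⇒↭ₛ (↭-sym ys++zs↭S)) (unique S))
    ys!      = proj₁ parts!
    zs!      = proj₁ (proj₂ parts!)

  toℕ-σ : ∀ xs → toℕ (foldr _∙_ ε xs) ≡ sum (map toℕ xs) % n
  toℕ-σ []       = toℕ-fromℕ< (m%n<n 0 n)
  toℕ-σ (x ∷ xs) = begin
    toℕ (x ∙ foldr _∙_ ε xs)                    ≡⟨ toℕ-fromℕ< (m%n<n _ n) ⟩
    (toℕ x + toℕ (foldr _∙_ ε xs)) % n          ≡⟨ cong (λ s → (toℕ x + s) % n) (toℕ-σ xs) ⟩
    (toℕ x + s % n) % n                         ≡⟨ %-distribˡ-+ (toℕ x) (s % n) n ⟩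
    (toℕ x % n + s % n % n) % n                 ≡⟨ cong (λ t → (toℕ x % n + t) % n) (m%n%n≡m%n s n) ⟩
    (toℕ x % n + s % n) % n                     ≡⟨ %-distribˡ-+ (toℕ x) s n ⟨
    (toℕ x + s) % n                             ∎
    where
    open ≡-Reasoning
    s = sum (map toℕ xs)

  -- Moves the zero-sum condition into ℕ, where inequalities can treat all `n` uniformly.
  σ≡ε⇔n∣sum : ∀ xs → foldr _∙_ ε xs ≡ ε ⇔ n ∣ sum (map toℕ xs)
  σ≡ε⇔n∣sum xs = mk⇔
    (λ σ≡ε → m%n≡0⇒n∣m _ n (trans (sym (toℕ-σ xs)) (trans (cong toℕ σ≡ε) toℕ-ε)))
    (λ n∣s → toℕ-injective (trans (toℕ-σ xs) (trans (n∣m⇒m%n≡0 _ n n∣s) (sym toℕ-ε))))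
    where
    toℕ-ε : toℕ ε ≡ 0
    -- `0 % n` is stuck for variable `n`; it is read as `0 * n % n`.
    toℕ-ε = trans (toℕ-σ []) (m*n%n≡0 0 n)

-- Settled by evaluation: at most 256 sublists for each order `suc (toℕ i)` from 1 to 8.
sublists-smallOrSplit : ∀ (i : Fin 8) → All (SmallOrSplits (suc (toℕ i))) (sublists (allFin (suc (toℕ i))))
sublists-smallOrSplit =
  from-yes (all? {n = 8} λ i → All.all? (smallOrSplits? (suc (toℕ i))) (sublists (allFin (suc (toℕ i)))))

admissible⇒partitionable : ∀ (i : Fin 8) S → Admissible (ℤ/ (suc (toℕ i))) S → Partitionable (ℤ/ (suc (toℕ i))) S
admissible⇒partitionable i S (divides q card≡ , σ≡ε) = go q card≡
  where
  n  = suc (toℕ i)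
  open AbelianGroup (ℤ/ n) using (isCommutativeMonoid; setoid)
  xs = filter (λ j → _∈?_ Fin._≟_ j (elements S)) (allFin n)

  xs↭S : xs ↭ elements S
  xs↭S = ↭-filter-allFin (unique S)

  smallOrSplits : SmallOrSplits n xs
  smallOrSplits = All.lookup (sublists-smallOrSplit i)
    (filter-∈-sublists (λ j → _∈?_ Fin._≟_ j (elements S)) (allFin n))

  go : ∀ q → card (ℤ/ n) S ≡ q * 3 → Partitionable (ℤ/ n) S
  go 0 c≡ = card≡0⇒partitionable (ℤ/ n) S c≡
  go 1 c≡ = card≡3⇒partitionable (ℤ/ n) S (c≡ , σ≡ε)
  go 2 c≡ = splitsIntoTriples⇒partitionable n S xs↭S
    (proj₂ smallOrSplits (trans (↭-length xs↭S) c≡)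
      (trans (Permutationₛ.foldr-commMonoid setoid isCommutativeMonoid (↭⇒↭ₛ xs↭S)) σ≡ε))
  -- At least nine elements, against the bound of eight.
  go (suc (suc (suc q))) c≡ = contradiction
    (subst (_≤ 8) (trans (↭-length xs↭S) c≡) (proj₁ smallOrSplits))
    (<⇒≱ (m≤m+n 9 (q * 3)))

-- The six-element set for `n ≥ 9`.

-- For n = 9 + k the residues ±1, ±2, ±4 are represented by base i + wrap i * k.
base wrap : Fin 6 → ℕ
base = lookup (1 ∷ 2 ∷ 4 ∷ 5 ∷ 7 ∷ 8 ∷ [])
wrap = lookup (0 ∷ 0 ∷ 0 ∷ 1 ∷ 1 ∷ 1 ∷ [])

-- Makes `base i + wrap i * k` strictly increasing in `i` for every `k`, so the six residues are
-- distinct.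
base-mono-< : ∀ i j → i Fin.< j → base i < base j × wrap i ≤ wrap j
base-mono-< = from-yes (all? {n = 6} λ i → all? λ j →
  i Fin.<? j →-dec (base i <? base j ×-dec wrap i ≤? wrap j))

base<9,wrap≤1 : ∀ i → base i < 9 × wrap i ≤ 1
base<9,wrap≤1 = from-yes (all? λ i → base i <? 9 ×-dec wrap i ≤? 1)

-- Forces q * (9 + k) < a + c * k < (1 + q) * (9 + k) for every k.
BetweenMultiples : ℕ → ℕ → Fin 3 → Set
BetweenMultiples a c q = toℕ q * 9 < a × toℕ q ≤ c × a < suc (toℕ q) * 9 × c ≤ suc (toℕ q)

betweenMultiples? : ∀ a c → Decidable (BetweenMultiples a c)
betweenMultiples? a c q = toℕ q * 9 <? a ×-dec toℕ q ≤? c ×-dec a <? suc (toℕ q) * 9 ×-dec c ≤? suc (toℕ q)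

-- The sums of `base` and `wrap` are free of `k`, so checking the index triples once covers every
-- `n ≥ 9`. Three residues below `n` sum to less than `3 * n`, which is why `q` in `Fin 3` suffices.
triples-between-multiples : ∀ i j l → i ≢ j → i ≢ l → j ≢ l →
  ∃[ q ] BetweenMultiples (base i + (base j + base l)) (wrap i + (wrap j + wrap l)) q
triples-between-multiples = from-yes (all? {n = 6} λ i → all? {n = 6} λ j → all? {n = 6} λ l →
  ¬? (i Fin.≟ j) →-dec ¬? (i Fin.≟ l) →-dec ¬? (j Fin.≟ l) →-dec
  any? (betweenMultiples? (base i + (base j + base l)) (wrap i + (wrap j + wrap l))))

-- Cancelling `9 + k` would place the quotient `t` strictly between `q` and `suc q`.
between-multiples⇒∤ : ∀ k {a c} → ∃[ q ] BetweenMultiples a c q → ¬ (9 + k ∣ a + c * k)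
between-multiples⇒∤ k {a} {c} (q′ , 9q<a , q≤c , a<9q+9 , c≤q+1) (divides t a+ck≡) =
  contradiction (*-cancelʳ-< (9 + k) q t above) (λ q<t → <⇒≱ (*-cancelʳ-< (9 + k) t (suc q) below) q<t)
  where
  open ≤-Reasoning
  q = toℕ q′
  above : q * (9 + k) < t * (9 + k)
  above = begin-strict
    q * (9 + k)    ≡⟨ *-distribˡ-+ q 9 k ⟩
    q * 9 + q * k  <⟨ +-mono-<-≤ 9q<a (*-monoˡ-≤ k q≤c) ⟩
    a + c * k      ≡⟨ a+ck≡ ⟩
    t * (9 + k)    ∎
  below : t * (9 + k) < suc q * (9 + k)
  below = begin-strict
    t * (9 + k)            ≡⟨ a+ck≡ ⟨
    a + c * k              <⟨ +-mono-<-≤ a<9q+9 (*-monoˡ-≤ k c≤q+1) ⟩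
    suc q * 9 + suc q * k  ≡⟨ *-distribˡ-+ (suc q) 9 k ⟨
    suc q * (9 + k)        ∎

module _ (k : ℕ) where

  private
    n = 9 + k
    G = ℤ/ n

  residue : Fin 6 → Fin n
  residue i = fromℕ< (+-mono-<-≤ (proj₁ (base<9,wrap≤1 i))
    (≤-trans (*-monoˡ-≤ k (proj₂ (base<9,wrap≤1 i))) (≤-reflexive (*-identityˡ k))))

  toℕ-residue : ∀ i → toℕ (residue i) ≡ base i + wrap i * k
  toℕ-residue i = toℕ-fromℕ< _

  ±1±2±4 : FiniteSubset G
  ±1±2±4 = mkFiniteSubset (tabulate residue) (AllPairs.tabulate⁺-< λ {i} {j} i<j ri≡rj →
    let b< , w≤ = base-mono-< i j i<j
    in <⇒≢ (+-mono-<-≤ b< (*-monoˡ-≤ k w≤))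
       (trans (sym (toℕ-residue i)) (trans (cong toℕ ri≡rj) (toℕ-residue j))))

  -- Each of the three pairs of opposite residues contributes `n`.
  sum-±1±2±4 : sum (map toℕ (elements ±1±2±4)) ≡ 3 * n
  sum-±1±2±4 = trans
    (cong sum (trans (map-tabulate residue toℕ) (tabulate-cong toℕ-residue)))
    (total k)
    where
    total : ∀ k → (1 + 0 * k) + ((2 + 0 * k) + ((4 + 0 * k) +
                  ((5 + 1 * k) + ((7 + 1 * k) + ((8 + 1 * k) + 0))))) ≡ 3 * (9 + k)
    total = solve-∀

  admissible : Admissible G ±1±2±4
  admissible = divides 2 refl , Equivalence.from (σ≡ε⇔n∣sum n (elements ±1±2±4)) (divides 3 sum-±1±2±4)

  no-zero-sum-triple : ∀ i j l → i ≢ j → i ≢ l → j ≢ l →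
    ¬ (n ∣ sum (map toℕ (residue i ∷ residue j ∷ residue l ∷ [])))
  no-zero-sum-triple i j l i≢j i≢l j≢l = subst (λ s → ¬ (n ∣ s)) (sym eq)
    (between-multiples⇒∤ k (triples-between-multiples i j l i≢j i≢l j≢l))
    where
    -- Collects the constants and the multiples of `k` into the form `a + c * k`.
    rearrange : ∀ a b c u v w k → (a + u * k) + ((b + v * k) + ((c + w * k) + 0)) ≡
                (a + (b + c)) + (u + (v + w)) * k
    rearrange = solve-∀
    eq : sum (map toℕ (residue i ∷ residue j ∷ residue l ∷ [])) ≡
         (base i + (base j + base l)) + (wrap i + (wrap j + wrap l)) * k
    eq rewrite toℕ-residue i | toℕ-residue j | toℕ-residue l =
      rearrange (base i) (base j) (base l) (wrap i) (wrap j) (wrap l) k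

  nonPartitionable : NonPartitionable G ±1±2±4
  nonPartitionable P with triple-in-partitionable G ±1±2±4 P (here refl)
  ... | mkFiniteSubset (x ∷ y ∷ z ∷ []) ((x≢y ∷ x≢z ∷ []) ∷ (y≢z ∷ []) ∷ _) , (refl , σ≡ε) , T⊆S
    with ∈-tabulate⁻ {f = residue} (T⊆S (here refl)) | ∈-tabulate⁻ {f = residue} (T⊆S (there (here refl)))
       | ∈-tabulate⁻ {f = residue} (T⊆S (there (there (here refl))))
  -- Equal indices would give equal residues, so the indices are distinct because the elements are.
  ... | i , refl | j , refl | l , refl =
    no-zero-sum-triple i j l (x≢y ∘ cong residue) (x≢z ∘ cong residue) (y≢z ∘ cong residue)
      (Equivalence.to (σ≡ε⇔n∣sum n (x ∷ y ∷ z ∷ [])) σ≡ε)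

-- Combining the two ranges of `n`.

n≤8⇒partitionable : ∀ n .{{_ : NonZero n}} → n ≤ 8 →
  ∀ (S : FiniteSubset (ℤ/ n)) → Admissible (ℤ/ n) S → Partitionable (ℤ/ n) S
-- `suc m ≤ 8` is by definition `m < 8`, which makes `m` an index in `Fin 8`.
n≤8⇒partitionable (suc m) m<8 = subst
  (λ m → ∀ (S : FiniteSubset (ℤ/ (suc m))) → Admissible (ℤ/ (suc m)) S → Partitionable (ℤ/ (suc m)) S)
  (toℕ-fromℕ< m<8) (admissible⇒partitionable (fromℕ< m<8))

n≥9⇒nonPartitionable : ∀ n .{{_ : NonZero n}} → n ≥ 9 →
        Σ[ S ∈ FiniteSubset (ℤ/ n) ] (card (ℤ/ n) S ≡ 6 × Admissible (ℤ/ n) S × NonPartitionable (ℤ/ n) S)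
n≥9⇒nonPartitionable n n≥9 with m≤n⇒∃[o]m+o≡n n≥9
... | k , refl = ±1±2±4 k , refl , admissible k , nonPartitionable k

corollary1p2 : (n : ℕ) .{{_ : NonZero n}} →
    ((n ≤ 8 → μ≡ (ℤ/ n) ⊤⁺) × (n ≥ 9 → μ≡ (ℤ/ n) [ 6 ])) ×
    ((n ≤ 8 → ∀ (S : FiniteSubset (ℤ/ n)) → Admissible (ℤ/ n) S → Partitionable (ℤ/ n) S) ×
    (n ≥ 9 → Σ[ S ∈ FiniteSubset (ℤ/ n) ] (card (ℤ/ n) S ≡ 6 × Admissible (ℤ/ n) S × NonPartitionable (ℤ/ n) S)))
corollary1p2 n =
  ( (λ n≤8 (S , adm , np) → np (n≤8⇒partitionable n n≤8 S adm))
  -- Minimality of 6 is the bound valid in every abelian group.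
  , (λ n≥9 → let S , c , adm , np = n≥9⇒nonPartitionable n n≥9 in (S , adm , np , c) , nonPartitionable⇒6≤card (ℤ/ n))
  ) , n≤8⇒partitionable n , n≥9⇒nonPartitionable n
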